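{- For every $k\ge 2$, it holds that $k\text{ -DIR}\subseteq k_{\mathrm{DIR}}\text{ -CONV}$.
   Context: All graphs are finite. A polygon is a closed convex polygon in $\mathbb{R}^2$. For a finite collection of sets, its intersection graph has one vertex for each member of the collection, and two distinct vertices are adjacent iff the corresponding sets have nonempty intersection. $k\text{ -DIR}$ is the class of intersection graphs of finite collections of straight-line segments in the plane in which all segments are parallel to at most $k$ directions. For a set $L$ of $k$ distinct lines through the origin in $\mathbb{R}^2$, $\mathcal{P}(L)$ is the family of all polygons each of whose sides is parallel to some line of $L$; $k_{\mathrm{DIR}(L)}\text{ -CONV}$ is the class of intersection graphs of finite collections of polygons from $\mathcal{P}(L)$, and $k_{\mathrm{DIR}}\text{ -CONV}$ is the union of $k_{\mathrm{DIR}(L)}\text{ -CONV}$ over all sets $L$ of $k$ distinct lines through the origin. -}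

module Defs where

open import Algebra.Bundles using (CommutativeRing)
open import Data.Fin.Base using (Fin; toℕ)
open import Data.Nat.Base as ℕ using (ℕ)
open import Data.Nat.DivMod using (_mod_)
open import Data.Product.Base using (Σ-syntax; ∃-syntax; _×_; _,_; proj₁; proj₂)
open import Function.Base using (_∘_)
open import Function.Bundles using (_⇔_)
open import Level using (Level; _⊔_; suc)
open import Relation.Binary.Core using (Rel)
open import Relation.Binary.Definitions using (Symmetric)
open import Relation.Binary.PropositionalEquality using (_≢_)
open import Relation.Binary.Structures using (IsStrictTotalOrder)
open import Relation.Nullary.Negation using (¬_)
open import Relation.Unary using (Pred; Satisfiable; _∈_; _≬_; _≐_)
import Algebra.Properties.Monoid.Sum as MonoidSum
import Relation.Binary.Construct.StrictToNonStrict as StrictToNonStrict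

-- The real numbers, given by the classical axioms of a complete ordered
-- field, which determine them up to isomorphism.  The order is trichotomous,
-- so equality and order of reals are decidable, as in classical mathematics.
record Reals (c ℓ₁ ℓ₂ : Level) : Set (suc (c ⊔ ℓ₁ ⊔ ℓ₂)) where
  field
    commutativeRing : CommutativeRing c ℓ₁

  open CommutativeRing commutativeRing public

  infix 4 _<_
  field
    _<_                : Rel Carrier ℓ₂
    isStrictTotalOrder : IsStrictTotalOrder _≈_ _<_

  open StrictToNonStrict _≈_ _<_ public using (_≤_)

  IsUpperBound : ∀ {p} → Pred Carrier p → Pred Carrier (c ⊔ ℓ₁ ⊔ ℓ₂ ⊔ p)
  IsUpperBound P b = ∀ x → x ∈ P → x ≤ b

  IsSupremum : ∀ {p} → Pred Carrier p → Pred Carrier (c ⊔ ℓ₁ ⊔ ℓ₂ ⊔ p)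
  IsSupremum P s = IsUpperBound P s × (∀ b → IsUpperBound P b → s ≤ b)

  field
    inverse       : ∀ x → ¬ (x ≈ 0#) → ∃[ y ] x * y ≈ 1#
    0<1           : 0# < 1#
    +-monoʳ-<     : ∀ x {y z} → y < z → x + y < x + z
    *-pos         : ∀ {x y} → 0# < x → 0# < y → 0# < x * y
    completeness  : (P : Pred Carrier (c ⊔ ℓ₁ ⊔ ℓ₂)) → Satisfiable P →
                    Satisfiable (IsUpperBound P) → Satisfiable (IsSupremum P)

  open MonoidSum +-monoid public using (sum)

record Graph (g : Level) : Set (suc g) where
  field
    order  : ℕ
    Adj    : Rel (Fin order) g
    sym    : Symmetric Adj
    irrefl : ∀ {i} → ¬ Adj i i

-- Collections are indexed families, so members may coincide as sets.
IsIntersectionGraphOf : ∀ {g a p} {A : Set a} (G : Graph g) →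
                        (Fin (Graph.order G) → Pred A p) → Set (g ⊔ a ⊔ p)
IsIntersectionGraphOf G F = ∀ i j → i ≢ j → Graph.Adj G i j ⇔ (F i ≬ F j)

module Plane {c ℓ₁ ℓ₂ : Level} (ℝ : Reals c ℓ₁ ℓ₂) where

  open Reals ℝ

  Point : Set c
  Point = Carrier × Carrier

  0ᵥ : Point
  0ᵥ = 0# , 0#

  infix 4 _≈ᵥ_
  _≈ᵥ_ : Rel Point ℓ₁
  (x₁ , y₁) ≈ᵥ (x₂ , y₂) = x₁ ≈ x₂ × y₁ ≈ y₂

  infixl 6 _+ᵥ_ _-ᵥ_
  infixr 7 _·ᵥ_

  _+ᵥ_ : Point → Point → Point
  (x₁ , y₁) +ᵥ (x₂ , y₂) = x₁ + x₂ , y₁ + y₂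

  _-ᵥ_ : Point → Point → Point
  (x₁ , y₁) -ᵥ (x₂ , y₂) = x₁ - x₂ , y₁ - y₂

  _·ᵥ_ : Carrier → Point → Point
  t ·ᵥ (x , y) = t * x , t * y

  sumᵥ : ∀ {n} → (Fin n → Point) → Point
  sumᵥ v = sum (proj₁ ∘ v) , sum (proj₂ ∘ v)

  det : Point → Point → Carrier
  det (x₁ , y₁) (x₂ , y₂) = x₁ * y₂ - y₁ * x₂

  -- Lines through the origin, presented by a spanning vector.  A direction is
  -- identified with the line through the origin having that direction.
  record Line : Set (c ⊔ ℓ₁) where
    field
      vector  : Point
      nonzero : ¬ (vector ≈ᵥ 0ᵥ)

  ⟦_⟧ˡ : Line → Pred Point (c ⊔ ℓ₁)
  ⟦ ℓ ⟧ˡ x = ∃[ t ] x ≈ᵥ t ·ᵥ Line.vector ℓ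

  record Lines (k : ℕ) : Set (c ⊔ ℓ₁) where
    field
      line     : Fin k → Line
      distinct : ∀ i j → i ≢ j → ¬ (⟦ line i ⟧ˡ ≐ ⟦ line j ⟧ˡ)

  -- For p and q different: the line through p and q is parallel to ℓ.
  Parallel : Point → Point → Line → Set (c ⊔ ℓ₁)
  Parallel p q ℓ = q -ᵥ p ∈ ⟦ ℓ ⟧ˡ

  record Segment : Set (c ⊔ ℓ₁) where
    field
      start end : Point
      proper    : ¬ (start ≈ᵥ end)

  ⟦_⟧ˢ : Segment → Pred Point (c ⊔ ℓ₁ ⊔ ℓ₂)
  ⟦ s ⟧ˢ x = ∃[ t ] (0# ≤ t × t ≤ 1# × x ≈ᵥ (1# - t) ·ᵥ start +ᵥ t ·ᵥ end)
    where open Segment s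

  ConvexHull : ∀ {n} → (Fin n → Point) → Pred Point (c ⊔ ℓ₁ ⊔ ℓ₂)
  ConvexHull {n} v x =
    Σ[ w ∈ (Fin n → Carrier) ]
      ((∀ i → 0# ≤ w i) × sum w ≈ 1# × x ≈ᵥ sumᵥ (λ i → w i ·ᵥ v i))

  -- A nondegenerate convex polygon, presented by its vertices in
  -- counterclockwise order: all vertices not on a side lie strictly to the
  -- left of that side.  This makes the vertices distinct, each of them a
  -- corner of the convex hull, and the cyclic order the one along the boundary.
  record Polygon : Set (c ⊔ ℓ₂) where
    field
      extra : ℕ

    vertexCount : ℕ
    vertexCount = 3 ℕ.+ extra

    next : Fin vertexCount → Fin vertexCount
    next i = ℕ.suc (toℕ i) mod vertexCount

    field
      vertex : Fin vertexCount → Point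
      convex : ∀ i j → j ≢ i → j ≢ next i →
               0# < det (vertex (next i) -ᵥ vertex i) (vertex j -ᵥ vertex i)

  ⟦_⟧ᵖ : Polygon → Pred Point (c ⊔ ℓ₁ ⊔ ℓ₂)
  ⟦ P ⟧ᵖ = ConvexHull (Polygon.vertex P)

  𝒫 : ∀ {k} → Lines k → Pred Polygon (c ⊔ ℓ₁)
  𝒫 {k} L P = ∀ i → Σ[ j ∈ Fin k ] Parallel (vertex i) (vertex (next i)) (Lines.line L j)
    where open Polygon P

  _-DIR : ∀ {g} → ℕ → Pred (Graph g) (g ⊔ c ⊔ ℓ₁ ⊔ ℓ₂)
  (k -DIR) G =
    Σ[ s ∈ (Fin (Graph.order G) → Segment) ]
      ((∃[ m ] (m ℕ.≤ k × (Σ[ L ∈ Lines m ] ∀ i → Σ[ j ∈ Fin m ]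
          Parallel (Segment.start (s i)) (Segment.end (s i)) (Lines.line L j))))
      × IsIntersectionGraphOf G (λ i → ⟦ s i ⟧ˢ))

  DIR⟨_⟩-CONV : ∀ {g k} → Lines k → Pred (Graph g) (g ⊔ c ⊔ ℓ₁ ⊔ ℓ₂)
  DIR⟨ L ⟩-CONV G =
    Σ[ P ∈ (Fin (Graph.order G) → Polygon) ]
      ((∀ i → P i ∈ 𝒫 L) × IsIntersectionGraphOf G (λ i → ⟦ P i ⟧ᵖ))

  _DIR-CONV : ∀ {g} → ℕ → Pred (Graph g) (g ⊔ c ⊔ ℓ₁ ⊔ ℓ₂)
  (k DIR-CONV) G = Σ[ L ∈ Lines k ] G ∈ DIR⟨ L ⟩-CONV

{-# OPTIONS --safe #-}
module Submission where

-- A segment ab is thickened to the parallelogram with vertices a, b, b + εu, a + εu, where u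
-- spans another line of the family and ε > 0 is common to all segments.  Meeting segments give
-- meeting parallelograms because each parallelogram contains its segment.  Two disjoint segments
-- are strictly separated by an affine functional, and it still separates the parallelograms once
-- ε is small; as there are finitely many pairs, one ε serves them all.

open import Algebra.Bundles using (CommutativeRing)
open import Defs
open import Level using (Level; _⊔_)

-- A segment cannot serve as its own polygon: a `Polygon` has at least three vertices and turns
-- strictly left at each side. The thickening must therefore leave the line of the segment while
-- staying inside the family, and `2 ≤ k` provides a second direction for that. A representation may
-- use fewer than `k` lines, perhaps only one, so the family is padded to exactly `k` before the
-- second direction is picked. The danger lies in new contacts. Disjointness is a bare negation,
-- whereas a bound on `ε` needs a quantitative margin. No compactness argument is used to get one:
-- the order is decidable, so comparing crossing parameters (for parallel segments, offsets and
-- positions along the line) yields either a common point or an explicit functional with strict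
-- signs at the four ends. Finitely many strict signs then give a threshold for `ε`.

-- Polynomial identities over a commutative ring, with integer coefficients.

module IntegerRingSolver {c ℓ} (R : CommutativeRing c ℓ) where

  open import Algebra.Properties.AbelianGroup (CommutativeRing.+-abelianGroup R)
  open import Algebra.Properties.Ring (CommutativeRing.ring R)
    using (-‿distribˡ-*; -‿distribʳ-*; -0#≈0#)
  open import Algebra.Properties.Semiring.Mult.TCOptimised (CommutativeRing.semiring R)
  import Algebra.Solver.Ring as RingSolver
  open import Algebra.Solver.Ring.AlmostCommutativeRing
    using (fromCommutativeRing; _-Raw-AlmostCommutative⟶_)
  open import Data.Integer.Base as ℤ using (ℤ; +_; -[1+_]; _⊖_; _◃_)
  import Data.Integer.Properties as ℤ
  open import Data.Maybe.Base using (map)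
  open import Data.Nat.Base as ℕ using (zero; suc)
  open import Data.Sign.Base using (Sign)
  open import Relation.Binary.PropositionalEquality.Core as ≡ using (_≡_)
  open import Relation.Nullary.Decidable.Core using (dec⇒maybe)
  open CommutativeRing R
  open import Relation.Binary.Reasoning.Setoid setoid

  -- Equality in an arbitrary commutative ring cannot be decided, so the solver could not cancel
  -- coefficients taken from `Carrier`; integer coefficients can be compared. With the optimised
  -- multiple, `con (+ 0)` and `con (+ 1)` denote `0#` and `1#` definitionally.
  fromℤ : ℤ → Carrier
  fromℤ (+ n)    = n × 1#
  fromℤ -[1+ n ] = - (suc n × 1#)

  fromℤ-cong : ∀ {i j} → i ≡ j → fromℤ i ≈ fromℤ j
  fromℤ-cong i≡j = reflexive (≡.cong fromℤ i≡j)

  fromℤ-⊖ : ∀ m n → fromℤ (m ⊖ n) ≈ m × 1# - n × 1#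
  fromℤ-⊖ zero zero = sym (-‿inverseʳ 0#)
  fromℤ-⊖ zero (suc n) = sym (+-identityˡ _)
  fromℤ-⊖ (suc m) zero = sym (trans (+-congˡ -0#≈0#) (+-identityʳ _))
  fromℤ-⊖ (suc m) (suc n) = begin
    fromℤ (suc m ⊖ suc n)                ≈⟨ fromℤ-cong (ℤ.[1+m]⊖[1+n]≡m⊖n m n) ⟩
    fromℤ (m ⊖ n)                        ≈⟨ fromℤ-⊖ m n ⟩
    m × 1# - n × 1#                      ≈⟨ +-congʳ (xyx⁻¹≈y 1# (m × 1#)) ⟨
    1# + m × 1# - 1# - n × 1#            ≈⟨ +-assoc _ _ _ ⟩
    1# + m × 1# + (- 1# - n × 1#)        ≈⟨ +-congˡ (⁻¹-∙-comm 1# (n × 1#)) ⟩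
    1# + m × 1# - (1# + n × 1#)          ≈⟨ +-cong (1+× m 1#) (-‿cong (1+× n 1#)) ⟨
    suc m × 1# - suc n × 1#              ∎

  fromℤ-+ : ∀ i j → fromℤ (i ℤ.+ j) ≈ fromℤ i + fromℤ j
  fromℤ-+ (+ m)    (+ n)    = ×-homo-+ 1# m n
  fromℤ-+ (+ m)    -[1+ n ] = fromℤ-⊖ m (suc n)
  fromℤ-+ -[1+ m ] (+ n)    = trans (fromℤ-⊖ n (suc m)) (+-comm _ _)
  fromℤ-+ -[1+ m ] -[1+ n ] = begin
    fromℤ (-[1+ m ] ℤ.+ -[1+ n ])      ≈⟨ fromℤ-cong (ℤ.neg-distrib-+ (+ suc m) (+ suc n)) ⟨
    - ((suc m ℕ.+ suc n) × 1#)         ≈⟨ -‿cong (×-homo-+ 1# (suc m) (suc n)) ⟩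
    - (suc m × 1# + suc n × 1#)        ≈⟨ ⁻¹-∙-comm _ _ ⟨
    - (suc m × 1#) - suc n × 1#        ∎

  fromℤ-neg : ∀ i → fromℤ (ℤ.- i) ≈ - fromℤ i
  fromℤ-neg (+ zero)  = sym -0#≈0#
  fromℤ-neg (+ suc n) = refl
  fromℤ-neg -[1+ n ]  = sym (⁻¹-involutive _)

  fromℤ-+◃ : ∀ n → fromℤ (Sign.+ ◃ n) ≈ n × 1#
  fromℤ-+◃ n = fromℤ-cong (ℤ.+◃n≡+n n)

  fromℤ--◃ : ∀ n → fromℤ (Sign.- ◃ n) ≈ - (n × 1#)
  fromℤ--◃ n = trans (fromℤ-cong (ℤ.-◃n≡-n n)) (fromℤ-neg (+ n))

  fromℤ-* : ∀ i j → fromℤ (i ℤ.* j) ≈ fromℤ i * fromℤ j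
  fromℤ-* (+ m) (+ n) = trans (fromℤ-+◃ (m ℕ.* n)) (×1-homo-* m n)
  fromℤ-* (+ m) -[1+ n ] = begin
    fromℤ (Sign.- ◃ m ℕ.* suc n)     ≈⟨ fromℤ--◃ (m ℕ.* suc n) ⟩
    - ((m ℕ.* suc n) × 1#)           ≈⟨ -‿cong (×1-homo-* m (suc n)) ⟩
    - (m × 1# * suc n × 1#)          ≈⟨ -‿distribʳ-* _ _ ⟩
    m × 1# * - (suc n × 1#)          ∎
  fromℤ-* -[1+ m ] (+ n) = begin
    fromℤ (Sign.- ◃ suc m ℕ.* n)     ≈⟨ fromℤ--◃ (suc m ℕ.* n) ⟩
    - ((suc m ℕ.* n) × 1#)           ≈⟨ -‿cong (×1-homo-* (suc m) n) ⟩
    - (suc m × 1# * n × 1#)          ≈⟨ -‿distribˡ-* _ _ ⟩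
    - (suc m × 1#) * n × 1#          ∎
  fromℤ-* -[1+ m ] -[1+ n ] = begin
    fromℤ (Sign.+ ◃ suc m ℕ.* suc n)  ≈⟨ fromℤ-+◃ (suc m ℕ.* suc n) ⟩
    (suc m ℕ.* suc n) × 1#            ≈⟨ ×1-homo-* (suc m) (suc n) ⟩
    suc m × 1# * suc n × 1#           ≈⟨ ⁻¹-involutive _ ⟨
    - - (suc m × 1# * suc n × 1#)     ≈⟨ -‿cong (-‿distribʳ-* _ _) ⟩
    - (suc m × 1# * - (suc n × 1#))   ≈⟨ -‿distribˡ-* _ _ ⟩
    - (suc m × 1#) * - (suc n × 1#)   ∎

  fromℤ-morphism : ℤ.+-*-rawRing -Raw-AlmostCommutative⟶ fromCommutativeRing R
  fromℤ-morphism = record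
    { ⟦_⟧    = fromℤ
    ; +-homo = fromℤ-+
    ; *-homo = fromℤ-*
    ; -‿homo = fromℤ-neg
    ; 0-homo = refl
    ; 1-homo = refl
    }

  open RingSolver ℤ.+-*-rawRing (fromCommutativeRing R) fromℤ-morphism
    (λ i j → map fromℤ-cong (dec⇒maybe (i ℤ.≟ j))) public
    using (Polynomial; solve; con; _:+_; _:*_; _:-_; :-_; _:=_)

-- Order, the unit interval and small positive numbers.

module OrderedField {c ℓ₁ ℓ₂ : Level} (ℝ : Reals c ℓ₁ ℓ₂) where

  open import Algebra.Properties.AbelianGroup (Reals.+-abelianGroup ℝ)
    using (x∙y⁻¹≈ε⇒x≈y)
  open import Data.Fin.Base using (Fin; zero; suc)
  open import Data.Integer.Base using (+_)
  open import Data.Nat.Base as ℕ using (ℕ)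
  open import Data.Product.Base using (∃-syntax; _×_; _,_)
  open import Data.Sum.Base using (inj₁; inj₂)
  open import Function.Base using (_∘_)
  open import Relation.Binary.Definitions using (tri<; tri≈; tri>)
  open import Relation.Binary.Structures using (IsStrictTotalOrder)
  open import Relation.Nullary.Negation using (¬_; contradiction)
  open import Relation.Unary using (Pred; _∩_)
  open Reals ℝ hiding (zero)
  open IntegerRingSolver commutativeRing
  open IsStrictTotalOrder isStrictTotalOrder public
    using (compare; _≟_; <-respʳ-≈; <-respˡ-≈)
    renaming (trans to <-trans; irrefl to <-irrefl)

  x-x≈0 : ∀ {x y} → x ≈ y → x - y ≈ 0#
  x-x≈0 {y = y} x≈y = trans (+-congʳ x≈y) (-‿inverseʳ y)

  -- Reduces an equation that depends on a hypothesis `p ≈ q` to an unconditional ring identity with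
  -- cofactor `k`. This is how equations such as `x * ι ≈ 1#` or a vanishing determinant reach the
  -- solver.
  ≈-multiple : ∀ {a b p q} k → p ≈ q → a - b ≈ k * (p - q) → a ≈ b
  ≈-multiple {a} {b} k p≈q eq = x∙y⁻¹≈ε⇒x≈y a b
    (trans eq (trans (*-congˡ (x-x≈0 p≈q)) (zeroʳ k)))

  x<y⇒0<y-x : ∀ {x y} → x < y → 0# < y - x
  x<y⇒0<y-x {x} {y} x<y =
    <-respˡ-≈ (-‿inverseˡ x) (<-respʳ-≈ (+-comm (- x) y) (+-monoʳ-< (- x) x<y))

  0<y-x⇒x<y : ∀ {x y} → 0# < y - x → x < y
  0<y-x⇒x<y {x} {y} 0<y-x = <-respˡ-≈ (+-identityʳ x)
    (<-respʳ-≈ (solve 2 (λ x y → x :+ (y :- x) := y) refl x y) (+-monoʳ-< x 0<y-x))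

  x≤y⇒0≤y-x : ∀ {x y} → x ≤ y → 0# ≤ y - x
  x≤y⇒0≤y-x (inj₁ x<y) = inj₁ (x<y⇒0<y-x x<y)
  x≤y⇒0≤y-x (inj₂ x≈y) = inj₂ (sym (x-x≈0 (sym x≈y)))

  0≤y-x⇒x≤y : ∀ {x y} → 0# ≤ y - x → x ≤ y
  0≤y-x⇒x≤y         (inj₁ 0<y-x) = inj₁ (0<y-x⇒x<y 0<y-x)
  0≤y-x⇒x≤y {x} {y} (inj₂ 0≈y-x) = inj₂ (sym (x∙y⁻¹≈ε⇒x≈y y x (sym 0≈y-x)))

  ≤-respʳ-≈ : ∀ {x y z} → y ≈ z → x ≤ y → x ≤ z
  ≤-respʳ-≈ y≈z (inj₁ x<y) = inj₁ (<-respʳ-≈ y≈z x<y)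
  ≤-respʳ-≈ y≈z (inj₂ x≈y) = inj₂ (trans x≈y y≈z)

  ≤-<-trans : ∀ {x y z} → x ≤ y → y < z → x < z
  ≤-<-trans (inj₁ x<y) y<z = <-trans x<y y<z
  ≤-<-trans (inj₂ x≈y) y<z = <-respˡ-≈ (sym x≈y) y<z

  <-≤-trans : ∀ {x y z} → x < y → y ≤ z → x < z
  <-≤-trans x<y (inj₁ y<z) = <-trans x<y y<z
  <-≤-trans x<y (inj₂ y≈z) = <-respʳ-≈ y≈z x<y

  0≤1 : 0# ≤ 1#
  0≤1 = inj₁ 0<1

  x<0⇒0<-x : ∀ {x} → x < 0# → 0# < - x
  x<0⇒0<-x x<0 = <-respʳ-≈ (+-identityˡ _) (x<y⇒0<y-x x<0)

  pos⇒≉0 : ∀ {x} → 0# < x → ¬ (x ≈ 0#)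
  pos⇒≉0 0<x x≈0 = <-irrefl (sym x≈0) 0<x

  pos-opposite : ∀ {x} → 0# < x → ¬ (0# < - x)
  pos-opposite {x} 0<x 0<-x = <-irrefl (sym (-‿inverseˡ x))
    (<-trans 0<-x (<-respˡ-≈ (+-identityʳ (- x)) (+-monoʳ-< (- x) 0<x)))

  +-pos-nonneg : ∀ {x y} → 0# < x → 0# ≤ y → 0# < x + y
  +-pos-nonneg {x} 0<x (inj₁ 0<y) =
    <-trans 0<x (<-respˡ-≈ (+-identityʳ x) (+-monoʳ-< x 0<y))
  +-pos-nonneg {x} 0<x (inj₂ 0≈y) =
    <-respʳ-≈ (trans (sym (+-identityʳ x)) (+-congˡ 0≈y)) 0<x

  +-pos : ∀ {x y} → 0# < x → 0# < y → 0# < x + y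
  +-pos 0<x 0<y = +-pos-nonneg 0<x (inj₁ 0<y)

  +-nonneg : ∀ {x y} → 0# ≤ x → 0# ≤ y → 0# ≤ x + y
  +-nonneg (inj₁ 0<x) 0≤y = inj₁ (+-pos-nonneg 0<x 0≤y)
  +-nonneg (inj₂ 0≈x) 0≤y = ≤-respʳ-≈ (trans (sym (+-identityˡ _)) (+-congʳ 0≈x)) 0≤y

  *-nonneg : ∀ {x y} → 0# ≤ x → 0# ≤ y → 0# ≤ x * y
  *-nonneg     (inj₁ 0<x) (inj₁ 0<y) = inj₁ (*-pos 0<x 0<y)
  *-nonneg {x} _          (inj₂ 0≈y) = inj₂ (trans (sym (zeroʳ x)) (*-congˡ 0≈y))
  *-nonneg     (inj₂ 0≈x) (inj₁ _)   = inj₂ (trans (sym (zeroˡ _)) (*-congʳ 0≈x))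

  square-pos : ∀ {x} → ¬ (x ≈ 0#) → 0# < x * x
  square-pos {x} x≉0 with compare x 0#
  ... | tri≈ _ x≈0 _ = contradiction x≈0 x≉0
  ... | tri> _ _ 0<x = *-pos 0<x 0<x
  ... | tri< x<0 _ _ = <-respʳ-≈ (solve 1 (λ x → :- x :* :- x := x :* x) refl x)
                         (*-pos (x<0⇒0<-x x<0) (x<0⇒0<-x x<0))

  square-nonneg : ∀ x → 0# ≤ x * x
  square-nonneg x with compare x 0#
  ... | tri≈ _ x≈0 _ = inj₂ (trans (sym (zeroʳ x)) (*-congˡ (sym x≈0)))
  ... | tri< _ x≉0 _ = inj₁ (square-pos x≉0)
  ... | tri> _ x≉0 _ = inj₁ (square-pos x≉0)

  -- `y` equals `x * (y * y)`, a positive number times a positive square.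
  inverse-pos : ∀ {x y} → 0# < x → x * y ≈ 1# → 0# < y
  inverse-pos {x} {y} 0<x xy≈1 = <-respʳ-≈ xyy≈y (*-pos 0<x (square-pos y≉0))
    where
    xyy≈y : x * (y * y) ≈ y
    xyy≈y = trans (sym (*-assoc x y y)) (trans (*-congʳ xy≈1) (*-identityˡ y))

    y≉0 : ¬ (y ≈ 0#)
    y≉0 y≈0 = pos⇒≉0 0<1 (trans (sym xy≈1) (trans (*-congˡ y≈0) (zeroʳ x)))

  -- If `x * y` vanished, so would `x * x * (y * y)`, which is a product of positive squares.
  *-≉0 : ∀ {x y} → ¬ (x ≈ 0#) → ¬ (y ≈ 0#) → ¬ (x * y ≈ 0#)
  *-≉0 {x} {y} x≉0 y≉0 xy≈0 = pos⇒≉0 (*-pos (square-pos x≉0) (square-pos y≉0))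
    (≈-multiple (x * y) xy≈0
      (solve 2 (λ x y → x :* x :* (y :* y) :- con (+ 0)
                        := x :* y :* (x :* y :- con (+ 0))) refl x y))

  between : ∀ {x y} → x < y → ∃[ m ] (x < m × m < y)
  between {x} {y} x<y =
    -- `h` is one half and the witness is the midpoint; both of its gaps equal `h * (y - x)`.
    let 0<2      = +-pos 0<1 0<1
        h , 2h≈1 = inverse (1# + 1#) (pos⇒≉0 0<2)
        0<h[y-x] = *-pos (inverse-pos 0<2 2h≈1) (x<y⇒0<y-x x<y)
    in  h * (x + y)
      , 0<y-x⇒x<y (<-respʳ-≈
          (sym (≈-multiple x 2h≈1
            (solve 3 (λ h x y → h :* (x :+ y) :- x :- h :* (y :- x)
                                := x :* ((con (+ 1) :+ con (+ 1)) :* h :- con (+ 1)))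
              refl h x y))) 0<h[y-x])
      , 0<y-x⇒x<y (<-respʳ-≈
          (≈-multiple y 2h≈1
            (solve 3 (λ h x y → h :* (y :- x) :- (y :- h :* (x :+ y))
                                := y :* ((con (+ 1) :+ con (+ 1)) :* h :- con (+ 1)))
              refl h x y)) 0<h[y-x])

  -- The last component is leastness in strict form; it is what makes room for a level between two
  -- pairs of values in `separate`.
  maximum : ∀ x y → ∃[ m ] (x ≤ m × y ≤ m × (∀ {z} → x < z → y < z → m < z))
  maximum x y with compare x y
  ... | tri< x<y _ _ = y , inj₁ x<y , inj₂ refl , λ _ y<z → y<z
  ... | tri≈ _ x≈y _ = y , inj₂ x≈y , inj₂ refl , λ _ y<z → y<z
  ... | tri> _ _ y<x = x , inj₂ refl , inj₁ y<x , λ x<z _ → x<z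

  minimum : ∀ x y → ∃[ m ] (m ≤ x × m ≤ y × (∀ {z} → z < x → z < y → z < m))
  minimum x y with compare x y
  ... | tri< x<y _ _ = x , inj₂ refl , inj₁ x<y , λ z<x _ → z<x
  ... | tri≈ _ x≈y _ = x , inj₂ refl , inj₂ x≈y , λ z<x _ → z<x
  ... | tri> _ _ y<x = y , inj₁ y<x , inj₂ refl , λ _ z<y → z<y

  strict-bound : ∀ {n} (f : Fin n → Carrier) → ∃[ b ] (∀ i → f i < b)
  strict-bound {ℕ.zero}  f = 0# , λ ()
  strict-bound {ℕ.suc n} f =
    let b , f<b              = strict-bound (f ∘ suc)
        m , f₀≤m , b≤m , _   = maximum (f zero) b
        m<m+1                = <-respˡ-≈ (+-identityʳ m) (+-monoʳ-< m 0<1)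
    in  m + 1# , λ { zero    → ≤-<-trans f₀≤m m<m+1
                   ; (suc i) → <-trans (<-≤-trans (f<b i) b≤m) m<m+1 }

  InUnit : Pred Carrier (ℓ₁ ⊔ ℓ₂)
  InUnit x = 0# ≤ x × x ≤ 1#

  data UnitPosition (x : Carrier) : Set (ℓ₁ ⊔ ℓ₂) where
    below  : x < 0# → UnitPosition x
    inside : InUnit x → UnitPosition x
    above  : 1# < x → UnitPosition x

  unitPosition : ∀ x → UnitPosition x
  unitPosition x with compare x 0# | compare x 1#
  ... | tri< x<0 _ _ | _            = below x<0
  ... | _            | tri> _ _ 1<x = above 1<x
  ... | tri≈ _ x≈0 _ | tri< x<1 _ _ = inside (inj₂ (sym x≈0) , inj₁ x<1)
  ... | tri≈ _ x≈0 _ | tri≈ _ x≈1 _ = inside (inj₂ (sym x≈0) , inj₂ x≈1)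
  ... | tri> _ _ 0<x | tri< x<1 _ _ = inside (inj₁ 0<x , inj₁ x<1)
  ... | tri> _ _ 0<x | tri≈ _ x≈1 _ = inside (inj₁ 0<x , inj₂ x≈1)

  -- Linear interpolation from `x` to `y` vanishes at `μ = - x / (y - x)`, and then
  -- `1# - μ = y / (y - x)`; both quotients are positive. Here `ι` is the inverse of `y - x`.
  zero-crossing : ∀ {x y} → x < 0# → 0# < y →
                  ∃[ μ ] (InUnit μ × (1# - μ) * x + μ * y ≈ 0#)
  zero-crossing {x} {y} x<0 0<y =
    let 0<-x      = x<0⇒0<-x x<0
        0<y-x     = +-pos 0<y 0<-x
        ι , dι≈1  = inverse (y - x) (pos⇒≉0 0<y-x)
        0<ι       = inverse-pos 0<y-x dι≈1
    in  - x * ι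
      , ( inj₁ (*-pos 0<-x 0<ι)
        , 0≤y-x⇒x≤y (≤-respʳ-≈
            (≈-multiple 1# dι≈1
              (solve 3 (λ x y ι → y :* ι :- (con (+ 1) :- :- x :* ι)
                                  := con (+ 1) :* ((y :- x) :* ι :- con (+ 1)))
                refl x y ι))
            (inj₁ (*-pos 0<y 0<ι))))
      , ≈-multiple (- x) dι≈1
          (solve 3 (λ x y ι → (con (+ 1) :- :- x :* ι) :* x :+ :- x :* ι :* y :- con (+ 0)
                              := :- x :* ((y :- x) :* ι :- con (+ 1)))
            refl x y ι)

  0∈Unit : InUnit 0#
  0∈Unit = inj₂ refl , 0≤1

  1∈Unit : InUnit 1#
  1∈Unit = 0≤1 , inj₂ refl

  -- Two collinear segments in a coordinate that puts the ends of the first at 0 and 1 and those of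
  -- the second at `x` and `y`, in either order. In `meets`, `s` and `t` are the parameters of a
  -- common point on the first and the second.
  data UnitIntervalMeets (x y : Carrier) : Set (c ⊔ ℓ₁ ⊔ ℓ₂) where
    meets      : ∀ {s t} → InUnit s → InUnit t → (1# - t) * x + t * y ≈ s → UnitIntervalMeets x y
    both-below : x < 0# → y < 0# → UnitIntervalMeets x y
    both-above : 1# < x → 1# < y → UnitIntervalMeets x y

  unitIntervalMeets : ∀ x y → UnitIntervalMeets x y
  unitIntervalMeets x y with unitPosition x | unitPosition y
  ... | inside x∈I | _          = meets x∈I 0∈Unit
          (solve 2 (λ x y → (con (+ 1) :- con (+ 0)) :* x :+ con (+ 0) :* y := x) refl x y)
  ... | _          | inside y∈I = meets y∈I 1∈Unit
          (solve 2 (λ x y → (con (+ 1) :- con (+ 1)) :* x :+ con (+ 1) :* y := y) refl x y)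
  ... | below x<0  | below y<0  = both-below x<0 y<0
  ... | above 1<x  | above 1<y  = both-above 1<x 1<y
  -- The ends straddle the unit interval, so 0 is a common point.
  ... | below x<0  | above 1<y  =
          let μ , μ∈I , eq = zero-crossing x<0 (<-trans 0<1 1<y) in meets 0∈Unit μ∈I eq
  -- The crossing is computed from `y` towards `x`, so the parameter counted from `x` is `1# - μ`.
  ... | above 1<x  | below y<0  =
          let μ , (0≤μ , μ≤1) , eq = zero-crossing y<0 (<-trans 0<1 1<x)
          in  meets 0∈Unit
                ( x≤y⇒0≤y-x μ≤1
                , 0≤y-x⇒x≤y (≤-respʳ-≈ (solve 1 (λ μ → μ := con (+ 1) :- (con (+ 1) :- μ)) refl μ) 0≤μ))
                (trans (solve 3 (λ x y μ → (con (+ 1) :- (con (+ 1) :- μ)) :* x :+ (con (+ 1) :- μ) :* y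
                                           := (con (+ 1) :- μ) :* y :+ μ :* x) refl x y μ) eq)

  -- The filter of right neighbourhoods of 0. Its closure under finite intersections replaces any
  -- bookkeeping of thresholds.
  Eventually : ∀ {p} → Pred Carrier p → Set (c ⊔ ℓ₂ ⊔ p)
  Eventually P = ∃[ δ ] (0# < δ × (∀ ε → 0# < ε → ε < δ → P ε))

  module _ {p} {P : Pred Carrier p} where

    eventually-map : ∀ {q} {Q : Pred Carrier q} → (∀ {ε} → P ε → Q ε) →
                     Eventually P → Eventually Q
    eventually-map P⇒Q (δ , 0<δ , Pδ) = δ , 0<δ , λ ε 0<ε ε<δ → P⇒Q (Pδ ε 0<ε ε<δ)

    eventually-always : (∀ ε → P ε) → Eventually P
    eventually-always P-all = 1# , 0<1 , λ ε _ _ → P-all ε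

    eventually-∩ : ∀ {q} {Q : Pred Carrier q} →
                   Eventually P → Eventually Q → Eventually (P ∩ Q)
    eventually-∩ (δ , 0<δ , Pδ) (δ′ , 0<δ′ , Qδ′) =
      let m , m≤δ , m≤δ′ , greatest = minimum δ δ′
      in  m , greatest 0<δ 0<δ′ , λ ε 0<ε ε<m →
            Pδ ε 0<ε (<-≤-trans ε<m m≤δ) , Qδ′ ε 0<ε (<-≤-trans ε<m m≤δ′)

    eventually⇒∃ : Eventually P → ∃[ ε ] (0# < ε × P ε)
    eventually⇒∃ (δ , 0<δ , Pδ) =
      let ε , 0<ε , ε<δ = between 0<δ in ε , 0<ε , Pδ ε 0<ε ε<δ

  eventually-∀ : ∀ {p n} {P : Fin n → Pred Carrier p} →
                 (∀ i → Eventually (P i)) → Eventually (λ ε → ∀ i → P i ε)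
  eventually-∀ {n = ℕ.zero}  eventually = eventually-always (λ _ ())
  eventually-∀ {n = ℕ.suc n} eventually =
    eventually-map (λ { (P₀ , Pₛ) zero → P₀ ; (P₀ , Pₛ) (suc i) → Pₛ i })
      (eventually-∩ (eventually zero) (eventually-∀ (eventually ∘ suc)))

  eventually-pos : ∀ {x} y → 0# < x → Eventually (λ ε → 0# < x + ε * y)
  eventually-pos {x} y 0<x with compare y 0#
  ... | tri> _ _ 0<y = 1# , 0<1 , λ ε 0<ε _ → +-pos 0<x (*-pos 0<ε 0<y)
  ... | tri≈ _ y≈0 _ = 1# , 0<1 , λ ε _ _ →
          +-pos-nonneg 0<x (inj₂ (trans (sym (zeroʳ ε)) (*-congˡ (sym y≈0))))
  ... | tri< y<0 _ _ =
    -- The threshold is `x / (- y)`, the zero of `x + ε * y`; below it the value is `- y` times the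
    -- remaining gap. In the other two cases the threshold 1 is arbitrary.
    let 0<-y     = x<0⇒0<-x y<0
        ι , yι≈1 = inverse (- y) (pos⇒≉0 0<-y)
    in  x * ι , *-pos 0<x (inverse-pos 0<-y yι≈1) , λ ε _ ε<xι →
          <-respʳ-≈
            (≈-multiple x yι≈1
              (solve 4 (λ x y ι ε → :- y :* (x :* ι :- ε) :- (x :+ ε :* y)
                                    := x :* (:- y :* ι :- con (+ 1))) refl x y ι ε))
            (*-pos 0<-y (x<y⇒0<y-x ε<xι))

  sum-nonneg : ∀ {n} (f : Fin n → Carrier) → (∀ i → 0# ≤ f i) → 0# ≤ sum f
  sum-nonneg {ℕ.zero}  f 0≤f = inj₂ refl
  sum-nonneg {ℕ.suc n} f 0≤f = +-nonneg (0≤f zero) (sum-nonneg (f ∘ suc) (0≤f ∘ suc))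

  -- Nonnegative weights with positive total include a positive one. The recursion skips zero
  -- weights until it meets the first such weight; the terms after it only have to be nonnegative.
  weighted-sum-pos : ∀ {n} (w f : Fin n → Carrier) → (∀ i → 0# ≤ w i) → (∀ i → 0# < f i) →
                     0# < sum w → 0# < sum (λ i → w i * f i)
  weighted-sum-pos {ℕ.zero}  w f 0≤w 0<f 0<0 = contradiction 0<0 (<-irrefl refl)
  weighted-sum-pos {ℕ.suc n} w f 0≤w 0<f 0<∑w with 0≤w zero
  ... | inj₁ 0<w₀ = +-pos-nonneg (*-pos 0<w₀ (0<f zero))
          (sum-nonneg _ (λ i → *-nonneg (0≤w (suc i)) (inj₁ (0<f (suc i)))))
  ... | inj₂ 0≈w₀ = <-respʳ-≈ (sym (trans (+-congʳ (trans (*-congʳ (sym 0≈w₀)) (zeroˡ _))) (+-identityˡ _)))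
          (weighted-sum-pos (w ∘ suc) (f ∘ suc) (0≤w ∘ suc) (0<f ∘ suc)
            (<-respʳ-≈ (trans (+-congʳ (sym 0≈w₀)) (+-identityˡ _)) 0<∑w))

-- Affine functionals, separation and segments that are not parallel.

module PlaneGeometry {ℓ ℓ₁ ℓ₂ : Level} (ℝ : Reals ℓ ℓ₁ ℓ₂) where

  open import Algebra.Properties.AbelianGroup (Reals.+-abelianGroup ℝ)
    using (⁻¹-involutive)
  open import Data.Fin.Base using (Fin; zero; suc)
  open import Data.Integer.Base using (+_)
  open import Data.Nat.Base as ℕ using (ℕ)
  open import Data.Product.Base using (∃-syntax; _×_; _,_; proj₁; proj₂)
  open import Data.Sum.Base using (_⊎_; inj₁; inj₂)
  open import Function.Base using (_∘_)
  open import Relation.Nullary.Decidable.Core using (yes; no)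
  open import Relation.Nullary.Negation using (¬_)
  open import Relation.Unary using (_∈_; _≬_)
  open Reals ℝ hiding (zero)
  open IntegerRingSolver commutativeRing
  open OrderedField ℝ
  open Plane ℝ

  -- Vectors of solver polynomials, so that identities can be written with determinants and dot
  -- products instead of expanded coordinates.
  Pointₚ : ℕ → Set
  Pointₚ n = Polynomial n × Polynomial n

  infixl 8 _:+ᵥ_ _:-ᵥ_
  infixr 9 _:·ᵥ_
  _:+ᵥ_ _:-ᵥ_ : ∀ {n} → Pointₚ n → Pointₚ n → Pointₚ n
  (x₁ , y₁) :+ᵥ (x₂ , y₂) = x₁ :+ x₂ , y₁ :+ y₂
  (x₁ , y₁) :-ᵥ (x₂ , y₂) = x₁ :- x₂ , y₁ :- y₂

  _:·ᵥ_ : ∀ {n} → Polynomial n → Pointₚ n → Pointₚ n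
  t :·ᵥ (x , y) = t :* x , t :* y

  detₚ dotₚ : ∀ {n} → Pointₚ n → Pointₚ n → Polynomial n
  detₚ (x₁ , y₁) (x₂ , y₂) = x₁ :* y₂ :- y₁ :* x₂
  dotₚ (x₁ , y₁) (x₂ , y₂) = x₁ :* x₂ :+ y₁ :* y₂

  :0 :1 : ∀ {n} → Polynomial n
  :0 = con (+ 0)
  :1 = con (+ 1)

  dot : Point → Point → Carrier
  dot (x₁ , y₁) (x₂ , y₂) = x₁ * x₂ + y₁ * y₂

  dot-pos : ∀ {v} → ¬ (v ≈ᵥ 0ᵥ) → 0# < dot v v
  dot-pos {x , y} v≉0 with x ≟ 0#
  ... | no  x≉0 = +-pos-nonneg (square-pos x≉0) (square-nonneg y)
  ... | yes x≈0 = <-respʳ-≈ (+-comm _ _)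
          (+-pos-nonneg (square-pos (λ y≈0 → v≉0 (x≈0 , y≈0))) (square-nonneg x))

  det-swap : ∀ v w → det v w ≈ - det w v
  det-swap (x₁ , y₁) (x₂ , y₂) =
    solve 4 (λ x₁ y₁ x₂ y₂ → x₁ :* y₂ :- y₁ :* x₂ := :- (x₂ :* y₁ :- y₂ :* x₁)) refl x₁ y₁ x₂ y₂

  det≈0-swap : ∀ {v w} → det v w ≈ 0# → det w v ≈ 0#
  det≈0-swap {v} {w} det≈0 = trans (det-swap w v) (trans (-‿cong det≈0)
    (solve 0 (:- :0 := :0) refl))

  -- (v·v) w = (v·w) v + det(v, w) v⊥, where v⊥ = (−v₂, v₁)
  det≈0⇒multiple : ∀ {v w ι} → dot v v * ι ≈ 1# → det v w ≈ 0# → w ≈ᵥ (ι * dot v w) ·ᵥ v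
  det≈0⇒multiple {v₁ , v₂} {w₁ , w₂} {ι} vvι≈1 det≈0 =
      trans (sym (≈-multiple w₁ vvι≈1
        (solve 5 (λ v₁ v₂ w₁ w₂ ι →
          let v = v₁ , v₂ ; w = w₁ , w₂ in
          ι :* dotₚ v w :* v₁ :- ι :* v₂ :* detₚ v w :- w₁ := w₁ :* (dotₚ v v :* ι :- :1))
          refl v₁ v₂ w₁ w₂ ι)))
        (≈-multiple (- (ι * v₂)) det≈0
          (solve 5 (λ v₁ v₂ w₁ w₂ ι →
          let v = v₁ , v₂ ; w = w₁ , w₂ in
          ι :* dotₚ v w :* v₁ :- ι :* v₂ :* detₚ v w :- ι :* dotₚ v w :* v₁
            := :- (ι :* v₂) :* (detₚ v w :- :0))
          refl v₁ v₂ w₁ w₂ ι))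
    , trans (sym (≈-multiple w₂ vvι≈1
        (solve 5 (λ v₁ v₂ w₁ w₂ ι →
          let v = v₁ , v₂ ; w = w₁ , w₂ in
          ι :* dotₚ v w :* v₂ :+ ι :* v₁ :* detₚ v w :- w₂ := w₂ :* (dotₚ v v :* ι :- :1))
          refl v₁ v₂ w₁ w₂ ι)))
        (≈-multiple (ι * v₁) det≈0
          (solve 5 (λ v₁ v₂ w₁ w₂ ι →
          let v = v₁ , v₂ ; w = w₁ , w₂ in
          ι :* dotₚ v w :* v₂ :+ ι :* v₁ :* detₚ v w :- ι :* dotₚ v w :* v₂
            := ι :* v₁ :* (detₚ v w :- :0))
          refl v₁ v₂ w₁ w₂ ι))

  Functional : Set ℓ
  Functional = Carrier × Carrier × Carrier

  eval : Functional → Point → Carrier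
  eval (α , β , γ) (x , y) = α + β * x + γ * y

  -- These are `p ↦ ι * det p v`, constant along `v`, and `p ↦ ι * dot v p`, which measures position
  -- along `v`. The factor `ι` allows a chosen segment to be given length 1.
  det-functional dot-functional : Carrier → Point → Functional
  det-functional ι (v₁ , v₂) = 0# , ι * v₂ , - (ι * v₁)
  dot-functional ι (v₁ , v₂) = 0# , ι * v₁ , ι * v₂

  eval-det-functional : ∀ ι v p q →
    eval (det-functional ι v) p - eval (det-functional ι v) q ≈ ι * det (p -ᵥ q) v
  eval-det-functional ι (v₁ , v₂) (p₁ , p₂) (q₁ , q₂) =
    solve 7 (λ ι v₁ v₂ p₁ p₂ q₁ q₂ →
        :0 :+ ι :* v₂ :* p₁ :+ :- (ι :* v₁) :* p₂ :- (:0 :+ ι :* v₂ :* q₁ :+ :- (ι :* v₁) :* q₂)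
        := ι :* detₚ ((p₁ , p₂) :-ᵥ (q₁ , q₂)) (v₁ , v₂))
      refl ι v₁ v₂ p₁ p₂ q₁ q₂

  eval-dot-functional : ∀ ι v p q →
    eval (dot-functional ι v) p - eval (dot-functional ι v) q ≈ ι * dot v (p -ᵥ q)
  eval-dot-functional ι (v₁ , v₂) (p₁ , p₂) (q₁ , q₂) =
    solve 7 (λ ι v₁ v₂ p₁ p₂ q₁ q₂ →
        :0 :+ ι :* v₁ :* p₁ :+ ι :* v₂ :* p₂ :- (:0 :+ ι :* v₁ :* q₁ :+ ι :* v₂ :* q₂)
        := ι :* dotₚ (v₁ , v₂) ((p₁ , p₂) :-ᵥ (q₁ , q₂)))
      refl ι v₁ v₂ p₁ p₂ q₁ q₂

  negate : Functional → Functional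
  negate (α , β , γ) = - α , - β , - γ

  above-level : Carrier → Functional → Functional
  above-level m (α , β , γ) = α - m , β , γ

  eval-above : ∀ m h p → eval (above-level m h) p ≈ eval h p - m
  eval-above m (α , β , γ) (x , y) =
    solve 6 (λ m α β γ x y → α :- m :+ β :* x :+ γ :* y := α :+ β :* x :+ γ :* y :- m) refl m α β γ x y

  eval-negate : ∀ h p → eval (negate h) p ≈ - eval h p
  eval-negate (α , β , γ) (x , y) =
    solve 5 (λ α β γ x y → :- α :+ :- β :* x :+ :- γ :* y := :- (α :+ β :* x :+ γ :* y)) refl α β γ x y

  eval-cong : ∀ h {p q} → p ≈ᵥ q → eval h p ≈ eval h q
  eval-cong h (x≈ , y≈) = +-cong (+-congˡ (*-congˡ x≈)) (*-congˡ y≈)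

  -- The tails of convex weights do not sum to 1, so the induction runs over arbitrary weights and
  -- the constant term carries the factor `sum w`.
  eval-sumᵥ : ∀ {n} h (w : Fin n → Carrier) (v : Fin n → Point) →
              sum (λ i → w i * eval h (v i)) ≈
              proj₁ h * sum w + proj₁ (proj₂ h) * proj₁ (sumᵥ (λ i → w i ·ᵥ v i))
                + proj₂ (proj₂ h) * proj₂ (sumᵥ (λ i → w i ·ᵥ v i))
  eval-sumᵥ {ℕ.zero} (α , β , γ) w v =
    solve 3 (λ α β γ → :0 := α :* :0 :+ β :* :0 :+ γ :* :0) refl α β γ
  eval-sumᵥ {ℕ.suc n} h@(α , β , γ) w v = trans
    (+-congˡ (eval-sumᵥ h (w ∘ suc) (v ∘ suc)))
    (solve 9 (λ α β γ w₀ x₀ y₀ w x y →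
        w₀ :* (α :+ β :* x₀ :+ γ :* y₀) :+ (α :* w :+ β :* x :+ γ :* y)
        := α :* (w₀ :+ w) :+ β :* (w₀ :* x₀ :+ x) :+ γ :* (w₀ :* y₀ :+ y))
      refl α β γ (w zero) (proj₁ (v zero)) (proj₂ (v zero)) (sum (w ∘ suc)) _ _)

  -- When the weights sum to 1, the value at `x` is the weighted mean of the values at the vertices.
  eval-hull-pos : ∀ {n} h {v : Fin n → Point} → (∀ i → 0# < eval h (v i)) →
                  ∀ {x} → x ∈ ConvexHull v → 0# < eval h x
  eval-hull-pos h {v} 0<hv (w , 0≤w , ∑w≈1 , x≈∑wv) = <-respʳ-≈
    (trans (eval-sumᵥ h w v)
      (trans (+-congʳ (+-congʳ (trans (*-congˡ ∑w≈1) (*-identityʳ _))))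
        (sym (eval-cong h x≈∑wv))))
    (weighted-sum-pos w (eval h ∘ v) 0≤w 0<hv (<-respʳ-≈ (sym ∑w≈1) 0<1))

  module _ (s : Segment) where
    open Segment s

    direction : Point
    direction = end -ᵥ start

    direction≉0 : ¬ (direction ≈ᵥ 0ᵥ)
    direction≉0 (x≈ , y≈) = proper
      ( sym (≈-multiple 1# x≈ (solve 2 (λ x y → y :- x := :1 :* (y :- x :- :0)) refl _ _))
      , sym (≈-multiple 1# y≈ (solve 2 (λ x y → y :- x := :1 :* (y :- x :- :0)) refl _ _)))

    PositiveOn : Functional → Set ℓ₂
    PositiveOn h = 0# < eval h start × 0# < eval h end

  Separated : Segment → Segment → Set (ℓ ⊔ ℓ₂)
  Separated s t = ∃[ h ] (PositiveOn s h × PositiveOn t (negate h))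

  Separated-sym : ∀ {s t} → Separated s t → Separated t s
  Separated-sym (h@(α , β , γ) , (0<a , 0<b) , 0<-cd) =
    negate h , 0<-cd , (<-respʳ-≈ (flip _) 0<a , <-respʳ-≈ (flip _) 0<b)
    where
    flip : ∀ p → eval h p ≈ eval (negate (negate h)) p
    flip p = +-cong (+-cong (sym (⁻¹-involutive α)) (*-congʳ (sym (⁻¹-involutive β))))
                    (*-congʳ (sym (⁻¹-involutive γ)))

  module _ (s t : Segment) where
    open Segment s renaming (start to a; end to b)
    open Segment t renaming (start to c; end to d)

    -- A level `m` strictly between the larger value on `t` and the smaller value on `s` is
    -- subtracted from `h`, which turns comparisons into signs.
    separate : ∀ h → eval h c < eval h a → eval h d < eval h a →
               eval h c < eval h b → eval h d < eval h b → Separated s t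
    separate h c<a d<a c<b d<b =
      let lo , c≤lo , d≤lo , least    = maximum (eval h c) (eval h d)
          hi , hi≤a , hi≤b , greatest = minimum (eval h a) (eval h b)
          m , lo<m , m<hi             = between (greatest (least c<a d<a) (least c<b d<b))
          over  = λ {p} (hi≤p : hi ≤ eval h p) →
            <-respʳ-≈ (sym (eval-above m h p)) (x<y⇒0<y-x (<-≤-trans m<hi hi≤p))
          under = λ {p} (p≤lo : eval h p ≤ lo) →
            <-respʳ-≈ (trans (solve 2 (λ e m → m :- e := :- (e :- m)) refl _ _)
                        (trans (-‿cong (sym (eval-above m h p))) (sym (eval-negate (above-level m h) p))))
              (x<y⇒0<y-x (≤-<-trans p≤lo lo<m))
      in  above-level m h , (over {a} hi≤a , over {b} hi≤b) , (under {c} c≤lo , under {d} d≤lo)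

    meet : ∀ {λ′ μ} → InUnit λ′ → InUnit μ →
           (1# - λ′) ·ᵥ a +ᵥ λ′ ·ᵥ b ≈ᵥ (1# - μ) ·ᵥ c +ᵥ μ ·ᵥ d → ⟦ s ⟧ˢ ≬ ⟦ t ⟧ˢ
    meet {λ′} {μ} (0≤λ , λ≤1) (0≤μ , μ≤1) eq =
      _ , (λ′ , 0≤λ , λ≤1 , refl , refl) , (μ , 0≤μ , μ≤1 , eq)


  module _ (s t : Segment) where
    open Segment s renaming (start to a; end to b)
    open Segment t renaming (start to c; end to d)

    -- Values of `h` are measured from its value at `a`, so that separation becomes a comparison of
    -- the relative values `x`, `y`, `z` of `b`, `c`, `d` with 0 and with one another.
    module _ (h : Functional) {x y z}
             (b-a≈x : eval h b - eval h a ≈ x)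
             (c-a≈y : eval h c - eval h a ≈ y)
             (d-a≈z : eval h d - eval h a ≈ z) where

      relative-< : ∀ {p q o x y} → p - o ≈ x → q - o ≈ y → x < y → p < q
      relative-< {p} {q} {o} p-o≈x q-o≈y x<y = 0<y-x⇒x<y (<-respʳ-≈
        (trans (+-cong (sym q-o≈y) (-‿cong (sym p-o≈x)))
          (solve 3 (λ p q o → q :- o :- (p :- o) := q :- p) refl p q o))
        (x<y⇒0<y-x x<y))

      a-a≈0 : eval h a - eval h a ≈ 0#
      a-a≈0 = -‿inverseʳ _

      separate-below : y < 0# → z < 0# → y < x → z < x → Separated s t
      separate-below y<0 z<0 y<x z<x = separate s t h
        (relative-< c-a≈y a-a≈0 y<0) (relative-< d-a≈z a-a≈0 z<0)
        (relative-< c-a≈y b-a≈x y<x) (relative-< d-a≈z b-a≈x z<x)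

      separate-above : 0# < y → 0# < z → x < y → x < z → Separated s t
      separate-above 0<y 0<z x<y x<z = Separated-sym {t} {s} (separate t s h
        (relative-< a-a≈0 c-a≈y 0<y) (relative-< b-a≈x c-a≈y x<y)
        (relative-< a-a≈0 d-a≈z 0<z) (relative-< b-a≈x d-a≈z x<z))

    private
      a₁ = proj₁ a
      a₂ = proj₂ a
      b₁ = proj₁ b
      b₂ = proj₂ b
      c₁ = proj₁ c
      c₂ = proj₂ c
      d₁ = proj₁ d
      d₂ = proj₂ d
      u = direction s
      v = direction t

    -- With `ι` inverse to `det u v`, this functional grows by exactly 1 along `s` and is constant
    -- along `t`. If the constant falls outside the range taken on `s`, the functional itself
    -- separates.
    module CrossingFunctional (ι : Carrier) (uvι≈1 : det u v * ι ≈ 1#) where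

      h : Functional
      h = det-functional ι v

      b-a≈1 : eval h b - eval h a ≈ 1#
      b-a≈1 = trans (eval-det-functional ι v b a) (trans (*-comm ι _) uvι≈1)

      c-a≈σ : eval h c - eval h a ≈ ι * det (c -ᵥ a) v
      c-a≈σ = eval-det-functional ι v c a

      d-a≈σ : eval h d - eval h a ≈ ι * det (c -ᵥ a) v
      d-a≈σ = trans (eval-det-functional ι v d a) (*-congˡ
        (solve 6 (λ a₁ a₂ c₁ c₂ d₁ d₂ →
            let a = a₁ , a₂ ; c = c₁ , c₂ ; d = d₁ , d₂ in
            detₚ (d :-ᵥ a) (d :-ᵥ c) := detₚ (c :-ᵥ a) (d :-ᵥ c))
          refl a₁ a₂ c₁ c₂ d₁ d₂))

    -- By Cramer's rule the line of t crosses s at the parameter ι det(c − a, v).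
    crossing-parameter : ∀ ι → det u v * ι ≈ 1# →
                         InUnit (ι * det (c -ᵥ a) v) ⊎ Separated s t
    crossing-parameter ι uvι≈1 with unitPosition (ι * det (c -ᵥ a) v)
    ... | inside σ∈I = inj₁ σ∈I
    ... | below σ<0  = inj₂ (separate-below h b-a≈1 c-a≈σ d-a≈σ
                         σ<0 σ<0 (<-trans σ<0 0<1) (<-trans σ<0 0<1))
      where open CrossingFunctional ι uvι≈1
    ... | above 1<σ  = inj₂ (separate-above h b-a≈1 c-a≈σ d-a≈σ
                         (<-trans 0<1 1<σ) (<-trans 0<1 1<σ) 1<σ 1<σ)
      where open CrossingFunctional ι uvι≈1

  -- The two lines cross in one point; the segments meet there as soon as its parameter on each of
  -- them lies in the unit interval, and a parameter outside gives a separating functional.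
  ¬parallel⇒meet⊎separated : ∀ s t → ¬ (det (direction s) (direction t) ≈ 0#) →
                             ⟦ s ⟧ˢ ≬ ⟦ t ⟧ˢ ⊎ Separated s t
  ¬parallel⇒meet⊎separated s t uv≉0
    with ι , uvι≈1 ← inverse _ uv≉0
    with crossing-parameter s t ι uvι≈1
       -- Exchanging the segments changes the sign of the determinant, hence of its inverse.
       | crossing-parameter t s (- ι) (trans (*-congʳ (det-swap (direction t) (direction s)))
           (trans (solve 2 (λ D ι → :- D :* :- ι := D :* ι) refl _ ι) uvι≈1))
  ... | inj₂ separated | _              = inj₂ separated
  ... | inj₁ _         | inj₂ separated = inj₂ (Separated-sym {t} {s} separated)
  -- Both parameters name the same point: the two expressions for each coordinate differ by a
  -- multiple of `det u v * ι - 1#`.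
  ... | inj₁ σ∈I       | inj₁ τ∈I       = inj₁ (meet s t σ∈I τ∈I
      ( ≈-multiple (c₁ - a₁) uvι≈1 (solve 9 (λ a₁ a₂ b₁ b₂ c₁ c₂ d₁ d₂ ι →
          let a = a₁ , a₂ ; b = b₁ , b₂ ; c = c₁ , c₂ ; d = d₁ , d₂
              u = b :-ᵥ a ; v = d :-ᵥ c
              σ = ι :* detₚ (c :-ᵥ a) v ; τ = :- ι :* detₚ (a :-ᵥ c) u in
          (:1 :- σ) :* a₁ :+ σ :* b₁ :- ((:1 :- τ) :* c₁ :+ τ :* d₁)
            := (c₁ :- a₁) :* (detₚ u v :* ι :- :1))
          refl a₁ a₂ b₁ b₂ c₁ c₂ d₁ d₂ ι)
      , ≈-multiple (c₂ - a₂) uvι≈1 (solve 9 (λ a₁ a₂ b₁ b₂ c₁ c₂ d₁ d₂ ι →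
          let a = a₁ , a₂ ; b = b₁ , b₂ ; c = c₁ , c₂ ; d = d₁ , d₂
              u = b :-ᵥ a ; v = d :-ᵥ c
              σ = ι :* detₚ (c :-ᵥ a) v ; τ = :- ι :* detₚ (a :-ᵥ c) u in
          (:1 :- σ) :* a₂ :+ σ :* b₂ :- ((:1 :- τ) :* c₂ :+ τ :* d₂)
            := (c₂ :- a₂) :* (detₚ u v :* ι :- :1))
          refl a₁ a₂ b₁ b₂ c₁ c₂ d₁ d₂ ι)))
    where
    a₁ = proj₁ (Segment.start s)
    a₂ = proj₂ (Segment.start s)
    b₁ = proj₁ (Segment.end s)
    b₂ = proj₂ (Segment.end s)
    c₁ = proj₁ (Segment.start t)
    c₂ = proj₂ (Segment.start t)
    d₁ = proj₁ (Segment.end t)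
    d₂ = proj₂ (Segment.end t)

-- Parallel segments, and the dichotomy between meeting and separation.

module SegmentSeparation {ℓ ℓ₁ ℓ₂ : Level} (ℝ : Reals ℓ ℓ₁ ℓ₂) where

  open import Data.Fin.Base using (Fin; zero)
  open import Data.Integer.Base using (+_)
  open import Data.Product.Base using (_,_; proj₁; proj₂)
  open import Data.Sum.Base using (_⊎_; inj₁; inj₂)
  open import Relation.Binary.Definitions using (tri<; tri≈; tri>)
  open import Relation.Nullary.Decidable.Core using (yes; no)
  open import Relation.Unary using (_≬_)
  open Reals ℝ hiding (zero)
  open IntegerRingSolver commutativeRing
  open OrderedField ℝ
  open Plane ℝ
  open PlaneGeometry ℝ

  module _ (s t : Segment) (uv≈0 : det (direction s) (direction t) ≈ 0#) where
    open Segment s renaming (start to a; end to b)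
    open Segment t renaming (start to c; end to d)

    private
      a₁ = proj₁ a
      a₂ = proj₂ a
      c₁ = proj₁ c
      c₂ = proj₂ c
      d₁ = proj₁ d
      d₂ = proj₂ d
      u = direction s

    -- Both ends of `t` have the same offset from the line of `s`: the difference is
    -- `det (d -ᵥ c) u`, the negative of the determinant assumed to vanish.
    parallel-det : det (d -ᵥ a) u ≈ det (c -ᵥ a) u
    parallel-det = ≈-multiple (- 1#) uv≈0
      (solve 8 (λ a₁ a₂ b₁ b₂ c₁ c₂ d₁ d₂ →
          let a = a₁ , a₂ ; b = b₁ , b₂ ; c = c₁ , c₂ ; d = d₁ , d₂ ; u = b :-ᵥ a in
          detₚ (d :-ᵥ a) u :- detₚ (c :-ᵥ a) u := :- :1 :* (detₚ u (d :-ᵥ c) :- :0))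
        refl a₁ a₂ (proj₁ b) (proj₂ b) c₁ c₂ d₁ d₂)

    private
      -- The offset of the line of `t` from the line of `s`. Its sign decides on which side `t`
      -- lies, and 0 means that the segments are collinear.
      e = 1# * det (c -ᵥ a) u
      h = det-functional 1# u

      b-a≈0 : eval h b - eval h a ≈ 0#
      b-a≈0 = trans (eval-det-functional 1# u b a)
        (solve 2 (λ x y → :1 :* (x :* y :- y :* x) := :0) refl (proj₁ u) (proj₂ u))

      c-a≈e : eval h c - eval h a ≈ e
      c-a≈e = eval-det-functional 1# u c a

      d-a≈e : eval h d - eval h a ≈ e
      d-a≈e = trans (eval-det-functional 1# u d a) (*-congˡ parallel-det)

    -- Position along `u`, scaled by the inverse of `dot u u`, puts `a` at 0 and `b` at 1 and leaves
    -- a question about intervals on a line.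
    collinear⇒meet⊎separated : det (c -ᵥ a) u ≈ 0# → ⟦ s ⟧ˢ ≬ ⟦ t ⟧ˢ ⊎ Separated s t
    collinear⇒meet⊎separated ca≈0
      with ι , uuι≈1 ← inverse _ (pos⇒≉0 (dot-pos (direction≉0 s)))
      with unitIntervalMeets (ι * dot u (c -ᵥ a)) (ι * dot u (d -ᵥ a))
    ... | both-below σ<0 τ<0 = inj₂ (separate-below s t (dot-functional ι u)
            (trans (eval-dot-functional ι u b a) (trans (*-comm ι _) uuι≈1))
            (eval-dot-functional ι u c a) (eval-dot-functional ι u d a)
            σ<0 τ<0 (<-trans σ<0 0<1) (<-trans τ<0 0<1))
    ... | both-above 1<σ 1<τ = inj₂ (separate-above s t (dot-functional ι u)
            (trans (eval-dot-functional ι u b a) (trans (*-comm ι _) uuι≈1))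
            (eval-dot-functional ι u c a) (eval-dot-functional ι u d a)
            (<-trans 0<1 1<σ) (<-trans 0<1 1<τ) 1<σ 1<τ)
    ... | meets {x} {y} x∈I y∈I eq = inj₁ (meet s t x∈I y∈I
            (coordinate (proj₁ c-a) (proj₁ d-a) , coordinate (proj₂ c-a) (proj₂ d-a)))
      where
      c-a = det≈0⇒multiple {u} {c -ᵥ a} uuι≈1 (det≈0-swap {c -ᵥ a} {u} ca≈0)
      d-a = det≈0⇒multiple {u} {d -ᵥ a} uuι≈1 (det≈0-swap {d -ᵥ a} {u} (trans parallel-det ca≈0))
      -- Here `a`, `b`, `c`, `d` are single coordinates, so one computation serves both axes:
      -- `c - a` and `d - a` are multiples of `b - a`, and the weighted mean of their factors is
      -- `x`.
      coordinate : ∀ {a b c d} → c - a ≈ ι * dot u (c₁ - a₁ , c₂ - a₂) * (b - a) →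
                   d - a ≈ ι * dot u (d₁ - a₁ , d₂ - a₂) * (b - a) →
                   (1# - x) * a + x * b ≈ (1# - y) * c + y * d
      coordinate {a} {b} {c} {d} c-a≈ d-a≈ = trans
        (solve 3 (λ a b x → (:1 :- x) :* a :+ x :* b := a :+ x :* (b :- a)) refl a b x)
        (trans (+-congˡ (*-congʳ (sym eq)))
        (trans (solve 5 (λ a u σ τ y → a :+ ((:1 :- y) :* σ :+ y :* τ) :* u
                           := a :+ ((:1 :- y) :* (σ :* u) :+ y :* (τ :* u))) refl a (b - a) _ _ y)
        (trans (+-congˡ (+-cong (*-congˡ (sym c-a≈)) (*-congˡ (sym d-a≈))))
        (solve 4 (λ a c d y → a :+ ((:1 :- y) :* (c :- a) :+ y :* (d :- a))
                     := (:1 :- y) :* c :+ y :* d) refl a c d y))))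

    parallel⇒meet⊎separated : ⟦ s ⟧ˢ ≬ ⟦ t ⟧ˢ ⊎ Separated s t
    parallel⇒meet⊎separated with compare e 0#
    ... | tri< e<0 _ _ = inj₂ (separate-below s t h b-a≈0 c-a≈e d-a≈e e<0 e<0 e<0 e<0)
    ... | tri> _ _ 0<e = inj₂ (separate-above s t h b-a≈0 c-a≈e d-a≈e 0<e 0<e 0<e 0<e)
    ... | tri≈ _ e≈0 _ = collinear⇒meet⊎separated (trans (sym (*-identityˡ _)) e≈0)

  meet⊎separated : ∀ s t → ⟦ s ⟧ˢ ≬ ⟦ t ⟧ˢ ⊎ Separated s t
  meet⊎separated s t with det (direction s) (direction t) ≟ 0#
  ... | yes uv≈0 = parallel⇒meet⊎separated s t uv≈0
  ... | no  uv≉0 = ¬parallel⇒meet⊎separated s t uv≉0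

-- Thin parallelograms, padding of the line family, and the inclusion of classes.

module Thickening {ℓ ℓ₁ ℓ₂ : Level} (ℝ : Reals ℓ ℓ₁ ℓ₂) where

  open import Data.Fin.Base using (Fin; zero; suc)
  open import Data.Fin.Patterns using (0F; 1F; 2F; 3F)
  open import Data.Nat.Base as ℕ using (_≤′_; ≤′-refl; ≤′-step)
  import Data.Nat.Properties as ℕ
  open import Data.Product.Base using (Σ-syntax; ∃-syntax; _×_; _,_; proj₁; proj₂)
  open import Data.Sum.Base using (inj₁; inj₂)
  open import Function.Base using (_∘_)
  open import Function.Bundles using (mk⇔; Equivalence)
  open import Relation.Binary.Definitions using (tri<; tri≈; tri>)
  open import Relation.Binary.PropositionalEquality.Core as ≡ using (_≡_; _≢_)
  open import Relation.Nullary.Decidable.Core using (yes; no)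
  open import Relation.Nullary.Negation using (¬_; contradiction)
  open import Relation.Unary using (_∈_; _⊆_; _≬_; _≐_)
  open Reals ℝ hiding (zero)
  open IntegerRingSolver commutativeRing
  open OrderedField ℝ
  open Plane ℝ
  open PlaneGeometry ℝ
  open SegmentSeparation ℝ

  strip : Segment → Point → Carrier → Fin 4 → Point
  strip s u ε 0F = Segment.start s
  strip s u ε 1F = Segment.end s
  strip s u ε 2F = Segment.end s +ᵥ ε ·ᵥ u
  strip s u ε 3F = Segment.start s +ᵥ ε ·ᵥ u

  stripₚ : ∀ {n} (a₁ a₂ b₁ b₂ u₁ u₂ ε : Polynomial n) → Fin 4 → Pointₚ n
  stripₚ a₁ a₂ b₁ b₂ u₁ u₂ ε 0F = a₁ , a₂
  stripₚ a₁ a₂ b₁ b₂ u₁ u₂ ε 1F = b₁ , b₂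
  stripₚ a₁ a₂ b₁ b₂ u₁ u₂ ε 2F = (b₁ , b₂) :+ᵥ ε :·ᵥ (u₁ , u₂)
  stripₚ a₁ a₂ b₁ b₂ u₁ u₂ ε 3F = (a₁ , a₂) :+ᵥ ε :·ᵥ (u₁ , u₂)

  module _ (s : Segment) {u : Point} (0<su : 0# < det (direction s) u)
           {ε : Carrier} (0<ε : 0# < ε) where

    private
      a₁ = proj₁ (Segment.start s)
      a₂ = proj₂ (Segment.start s)
      b₁ = proj₁ (Segment.end s)
      b₂ = proj₂ (Segment.end s)
      u₁ = proj₁ u
      u₂ = proj₂ u

      -- Any three vertices of a parallelogram span half of it, so the eight determinants required
      -- by `convex` all equal `ε * det (direction s) u`.
      areaₚ : Fin 4 → Fin 4 → Fin 4 → (a₁ a₂ b₁ b₂ u₁ u₂ ε : Polynomial 7) → Polynomial 7 × Polynomial 7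
      areaₚ i j k a₁ a₂ b₁ b₂ u₁ u₂ ε =
          ε :* detₚ ((b₁ , b₂) :-ᵥ (a₁ , a₂)) (u₁ , u₂)
        := detₚ (v j :-ᵥ v i) (v k :-ᵥ v i)
        where v = stripₚ a₁ a₂ b₁ b₂ u₁ u₂ ε

      0<area : 0# < ε * det (direction s) u
      0<area = *-pos 0<ε 0<su

    parallelogram : Polygon
    parallelogram = record
      { extra  = 1
      ; vertex = strip s u ε
      ; convex = λ
        { 0F 0F j≢i _ → contradiction ≡.refl j≢i
        ; 0F 1F _ j≢n → contradiction ≡.refl j≢n
        ; 0F 2F _ _ → <-respʳ-≈ (solve 7 (areaₚ 0F 1F 2F) refl a₁ a₂ b₁ b₂ u₁ u₂ ε) 0<area
        ; 0F 3F _ _ → <-respʳ-≈ (solve 7 (areaₚ 0F 1F 3F) refl a₁ a₂ b₁ b₂ u₁ u₂ ε) 0<area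
        ; 1F 0F _ _ → <-respʳ-≈ (solve 7 (areaₚ 1F 2F 0F) refl a₁ a₂ b₁ b₂ u₁ u₂ ε) 0<area
        ; 1F 1F j≢i _ → contradiction ≡.refl j≢i
        ; 1F 2F _ j≢n → contradiction ≡.refl j≢n
        ; 1F 3F _ _ → <-respʳ-≈ (solve 7 (areaₚ 1F 2F 3F) refl a₁ a₂ b₁ b₂ u₁ u₂ ε) 0<area
        ; 2F 0F _ _ → <-respʳ-≈ (solve 7 (areaₚ 2F 3F 0F) refl a₁ a₂ b₁ b₂ u₁ u₂ ε) 0<area
        ; 2F 1F _ _ → <-respʳ-≈ (solve 7 (areaₚ 2F 3F 1F) refl a₁ a₂ b₁ b₂ u₁ u₂ ε) 0<area
        ; 2F 2F j≢i _ → contradiction ≡.refl j≢i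
        ; 2F 3F _ j≢n → contradiction ≡.refl j≢n
        ; 3F 0F _ j≢n → contradiction ≡.refl j≢n
        ; 3F 1F _ _ → <-respʳ-≈ (solve 7 (areaₚ 3F 0F 1F) refl a₁ a₂ b₁ b₂ u₁ u₂ ε) 0<area
        ; 3F 2F _ _ → <-respʳ-≈ (solve 7 (areaₚ 3F 0F 2F) refl a₁ a₂ b₁ b₂ u₁ u₂ ε) 0<area
        ; 3F 3F j≢i _ → contradiction ≡.refl j≢i
        }
      }

    parallelogram-∈𝒫 : ∀ {k} (L : Lines k) {i j} →
      Parallel (Segment.start s) (Segment.end s) (Lines.line L i) → u ∈ ⟦ Lines.line L j ⟧ˡ →
      parallelogram ∈ 𝒫 L
    parallelogram-∈𝒫 L {i} {j} (σ , s₁≈ , s₂≈) (τ , u₁≈ , u₂≈) = λ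
      -- Opposite sides are traversed in opposite senses, whence the multipliers `σ`, `ε * τ`,
      -- `- σ`, `- (ε * τ)`.
      { 0F → i , σ , s₁≈ , s₂≈
      ; 1F → j , ε * τ , side-u b₁ u₁≈ , side-u b₂ u₂≈
      ; 2F → i , - σ , side-s s₁≈ , side-s s₂≈
      ; 3F → j , - (ε * τ) , side-u⁻ a₁ u₁≈ , side-u⁻ a₂ u₂≈
      }
      where
      side-u : ∀ p {u v} → u ≈ τ * v → p + ε * u - p ≈ ε * τ * v
      side-u p {u} {v} u≈ = trans (solve 3 (λ p ε u → p :+ ε :* u :- p := ε :* u) refl p ε u)
        (trans (*-congˡ u≈) (sym (*-assoc ε τ v)))

      side-s : ∀ {a b u v} → b - a ≈ σ * v → a + ε * u - (b + ε * u) ≈ - σ * v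
      side-s {a} {b} {u} {v} b-a≈ = trans
        (solve 4 (λ a b ε u → a :+ ε :* u :- (b :+ ε :* u) := :- (b :- a)) refl a b ε u)
        (trans (-‿cong b-a≈) (solve 2 (λ σ v → :- (σ :* v) := :- σ :* v) refl σ v))

      side-u⁻ : ∀ p {u v} → u ≈ τ * v → p - (p + ε * u) ≈ - (ε * τ) * v
      side-u⁻ p {u} {v} u≈ = trans (solve 3 (λ p ε u → p :- (p :+ ε :* u) := :- (ε :* u)) refl p ε u)
        (trans (-‿cong (*-congˡ u≈))
          (solve 3 (λ ε τ v → :- (ε :* (τ :* v)) := :- (ε :* τ) :* v) refl ε τ v))

  segment⊆strip : ∀ s u ε → ⟦ s ⟧ˢ ⊆ ConvexHull (strip s u ε)
  segment⊆strip s u ε (t , 0≤t , t≤1 , x≈ , y≈) =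
      w
    , (λ { 0F → x≤y⇒0≤y-x t≤1 ; 1F → 0≤t ; 2F → inj₂ refl ; 3F → inj₂ refl })
    , solve 1 (λ t → :1 :- t :+ (t :+ (:0 :+ (:0 :+ :0))) := :1) refl t
    , trans x≈ (coordinate t _ _ _ _) , trans y≈ (coordinate t _ _ _ _)
    where
    w : Fin 4 → Carrier
    w 0F = 1# - t
    w 1F = t
    w 2F = 0#
    w 3F = 0#

    coordinate : ∀ t a b c d → (1# - t) * a + t * b ≈ (1# - t) * a + (t * b + (0# * c + (0# * d + 0#)))
    coordinate = solve 5 (λ t a b c d → (:1 :- t) :* a :+ t :* b
                            := (:1 :- t) :* a :+ (t :* b :+ (:0 :* c :+ (:0 :* d :+ :0)))) refl

  -- Along a shift the value is affine in `ε`, the shape that `eventually-pos` expects.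
  eval-shift : ∀ h p u ε →
    eval h p + ε * (proj₁ (proj₂ h) * proj₁ u + proj₂ (proj₂ h) * proj₂ u) ≈
    eval h (p +ᵥ ε ·ᵥ u)
  eval-shift (α , β , γ) (x , y) (u₁ , u₂) ε = solve 8 (λ α β γ x y u₁ u₂ ε →
      α :+ β :* x :+ γ :* y :+ ε :* (β :* u₁ :+ γ :* u₂)
      := α :+ β :* (x :+ ε :* u₁) :+ γ :* (y :+ ε :* u₂)) refl α β γ x y u₁ u₂ ε

  strip-eventually-pos : ∀ s u h → PositiveOn s h →
                         Eventually (λ ε → ∀ i → 0# < eval h (strip s u ε i))
  strip-eventually-pos s u h (0<a , 0<b) = eventually-∀ λ
    { 0F → eventually-always (λ _ → 0<a)
    ; 1F → eventually-always (λ _ → 0<b)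
    ; 2F → eventually-map (<-respʳ-≈ (eval-shift h _ u _)) (eventually-pos _ 0<b)
    ; 3F → eventually-map (<-respʳ-≈ (eval-shift h _ u _)) (eventually-pos _ 0<a)
    }

  -- At a common point of the two hulls both `h` and its negation would be positive.
  separated⇒strips-eventually-disjoint : ∀ {s t} u v → Separated s t →
    Eventually (λ ε → ¬ (ConvexHull (strip s u ε) ≬ ConvexHull (strip t v ε)))
  separated⇒strips-eventually-disjoint {s} {t} u v (h , h-pos , -h-pos) =
    eventually-map
      (λ { (0<s , 0<t) (x , x∈s , x∈t) → pos-opposite (eval-hull-pos h 0<s x∈s)
           (<-respʳ-≈ (eval-negate h x) (eval-hull-pos (negate h) 0<t x∈t)) })
      (eventually-∩ (strip-eventually-pos s u h h-pos) (strip-eventually-pos t v (negate h) -h-pos))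

  parallel⇒∈ : ∀ (l m : Line) → det (Line.vector l) (Line.vector m) ≈ 0# → Line.vector m ∈ ⟦ l ⟧ˡ
  parallel⇒∈ l m lm≈0 =
    let ι , eq = inverse _ (pos⇒≉0 (dot-pos (Line.nonzero l))) in
    _ , det≈0⇒multiple {Line.vector l} {Line.vector m} eq lm≈0

  ∈⇒⊆ : ∀ (l m : Line) → Line.vector m ∈ ⟦ l ⟧ˡ → ⟦ m ⟧ˡ ⊆ ⟦ l ⟧ˡ
  ∈⇒⊆ l m (σ , m₁≈ , m₂≈) (τ , x≈ , y≈) = τ * σ
    , trans x≈ (trans (*-congˡ m₁≈) (sym (*-assoc _ _ _)))
    , trans y≈ (trans (*-congˡ m₂≈) (sym (*-assoc _ _ _)))

  distinct⇒det≉0 : ∀ {k} (L : Lines k) {i j} → i ≢ j →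
                   ¬ (det (Line.vector (Lines.line L i)) (Line.vector (Lines.line L j)) ≈ 0#)
  distinct⇒det≉0 L {i} {j} i≢j ij≈0 = Lines.distinct L i j i≢j
    ( ∈⇒⊆ m l (parallel⇒∈ m l (det≈0-swap {Line.vector l} {Line.vector m} ij≈0))
    , ∈⇒⊆ l m (parallel⇒∈ l m ij≈0) )
    where
    l = Lines.line L i
    m = Lines.line L j

  ∈⇒det≈0 : ∀ l {p} → p ∈ ⟦ l ⟧ˡ → det (Line.vector l) p ≈ 0#
  ∈⇒det≈0 l {p₁ , p₂} (t , p₁≈ , p₂≈) = trans (+-cong (*-congˡ p₂≈) (-‿cong (*-congˡ p₁≈)))
    (solve 3 (λ t x y → x :* (t :* y) :- y :* (t :* x) := :0) refl t _ _)

  vector∈ : ∀ l → Line.vector l ∈ ⟦ l ⟧ˡ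
  vector∈ l = 1# , sym (*-identityˡ _) , sym (*-identityˡ _)

  -- For `v = (x , y)` the determinant is `x * T - y`. If `x` is nonzero its only root is `y / x`,
  -- taken as the bound; otherwise it is the nonzero constant `- y`, and the bound 0 is arbitrary.
  steep-not-parallel : ∀ v → ¬ (v ≈ᵥ 0ᵥ) → ∃[ b ] (∀ T → b < T → ¬ (det v (1# , T) ≈ 0#))
  steep-not-parallel (x , y) v≉0 with x ≟ 0#
  ... | yes x≈0 = 0# , λ T _ det≈0 → v≉0 (x≈0 , trans
          (solve 3 (λ x y T → y := x :* T :- (x :* T :- y :* :1)) refl x y T)
          (trans (+-cong (trans (*-congʳ x≈0) (zeroˡ T)) (-‿cong det≈0)) (-‿inverseʳ 0#)))
  ... | no  x≉0 =
          let ι , xι≈1 = inverse x x≉0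
          in  y * ι , λ T yι<T det≈0 → <-irrefl
                (trans
                  (≈-multiple (- ι) det≈0 (solve 4 (λ x y T ι →
                    y :* ι :- x :* ι :* T := :- ι :* (x :* T :- y :* :1 :- :0)) refl x y T ι))
                  (trans (*-congʳ xι≈1) (*-identityˡ T)))
                yι<T

  -- Finitely many lines exclude only finitely many slopes, so any slope above all the bounds is
  -- free.
  transversal : ∀ {k} (l : Fin k → Line) →
                Σ[ m ∈ Line ] (∀ i → ¬ (det (Line.vector (l i)) (Line.vector m) ≈ 0#))
  transversal l =
    let steep     = λ i → steep-not-parallel (Line.vector (l i)) (Line.nonzero (l i))
        T , bound = strict-bound (proj₁ ∘ steep)
    in  record { vector = 1# , T ; nonzero = λ { (1≈0 , _) → pos⇒≉0 0<1 1≈0 } }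
      , λ i → proj₂ (steep i) T (bound i)

  add-line : ∀ {k} → Lines k → Lines (ℕ.suc k)
  add-line {k} L = record { line = line′ ; distinct = distinct′ }
    where
    open Lines L
    m = proj₁ (transversal line)

    line′ : Fin (ℕ.suc k) → Line
    line′ zero    = m
    line′ (suc i) = line i

    m-not-parallel : ∀ i → ¬ (Line.vector m ∈ ⟦ line i ⟧ˡ)
    m-not-parallel i m∈ = proj₂ (transversal line) i (∈⇒det≈0 (line i) m∈)

    distinct′ : ∀ i j → i ≢ j → ¬ (⟦ line′ i ⟧ˡ ≐ ⟦ line′ j ⟧ˡ)
    distinct′ zero    zero    i≢j _         = i≢j ≡.refl
    distinct′ zero    (suc j) _   (m⊆l , _) = m-not-parallel j (m⊆l (vector∈ m))
    distinct′ (suc i) zero    _   (_ , m⊆l) = m-not-parallel i (m⊆l (vector∈ m))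
    distinct′ (suc i) (suc j) i≢j           = distinct i j (i≢j ∘ ≡.cong suc)

  -- `k -DIR` permits any `m` up to `k`, while `k DIR-CONV` demands exactly `k` distinct lines. Each
  -- new line takes index 0 and shifts the old ones, so old lines are found again through a
  -- reindexing.
  extend-lines : ∀ {m k} → m ≤′ k → (L : Lines m) →
                 Σ[ L′ ∈ Lines k ] (∀ i → ∃[ j ] Lines.line L′ j ≡ Lines.line L i)
  extend-lines ≤′-refl       L = L , λ i → i , ≡.refl
  extend-lines (≤′-step m≤k) L =
    let L′ , L⊆L′ = extend-lines m≤k L
    in  add-line L′ , λ i → let j , eq = L⊆L′ i in suc j , eq

  another : ∀ {k} → 2 ℕ.≤ k → (i : Fin k) → ∃[ j ] i ≢ j
  another (ℕ.s≤s (ℕ.s≤s _)) zero    = 1F , λ ()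
  another (ℕ.s≤s (ℕ.s≤s _)) (suc i) = 0F , λ ()

  -- The sign matters because polygon vertices are listed counterclockwise. A spanning vector that
  -- points to the right of `s` is replaced by its negative, which spans the same line.
  left-transversal : ∀ {k} → 2 ℕ.≤ k → (L : Lines k) (s : Segment) → ∀ {i} →
    direction s ∈ ⟦ Lines.line L i ⟧ˡ →
    Σ[ u ∈ Point ] (0# < det (direction s) u × ∃[ j ] u ∈ ⟦ Lines.line L j ⟧ˡ)
  left-transversal 2≤k L s {i} (σ , s₁≈ , s₂≈)
    with j , i≢j ← another 2≤k i
    with compare (det (direction s) (Line.vector (Lines.line L j))) 0#
  ... | tri> _ _ 0<sv = Line.vector (Lines.line L j) , 0<sv , j , vector∈ (Lines.line L j)
  ... | tri< sv<0 _ _ = let v = Line.vector (Lines.line L j) in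
          - 1# ·ᵥ v
        , <-respʳ-≈ (solve 4 (λ s₁ s₂ v₁ v₂ → :- (s₁ :* v₂ :- s₂ :* v₁)
                        := s₁ :* (:- :1 :* v₂) :- s₂ :* (:- :1 :* v₁))
                      refl (proj₁ (direction s)) (proj₂ (direction s)) (proj₁ v) (proj₂ v))
            (x<0⇒0<-x sv<0)
        , j , - 1# , refl , refl
  -- `direction s` is `σ` times `l` with `σ` nonzero, so a zero determinant here would make two
  -- distinct lines of `L` parallel.
  ... | tri≈ _ sv≈0 _ = contradiction lv≈0 (distinct⇒det≉0 L i≢j)
    where
    l = Line.vector (Lines.line L i)
    v = Line.vector (Lines.line L j)

    σ≉0 : ¬ (σ ≈ 0#)
    σ≉0 σ≈0 = direction≉0 s
      ( trans s₁≈ (trans (*-congʳ σ≈0) (zeroˡ _))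
      , trans s₂≈ (trans (*-congʳ σ≈0) (zeroˡ _)))

    σlv≈0 : σ * det l v ≈ 0#
    σlv≈0 = trans (solve 5 (λ σ l₁ l₂ v₁ v₂ → σ :* (l₁ :* v₂ :- l₂ :* v₁)
                               := σ :* l₁ :* v₂ :- σ :* l₂ :* v₁)
                    refl σ (proj₁ l) (proj₂ l) (proj₁ v) (proj₂ v))
      (trans (+-cong (*-congʳ (sym s₁≈)) (-‿cong (*-congʳ (sym s₂≈)))) sv≈0)

    lv≈0 : det l v ≈ 0#
    lv≈0 with det l v ≟ 0#
    ... | yes lv≈0 = lv≈0
    ... | no  lv≉0 = contradiction σlv≈0 (*-≉0 σ≉0 lv≉0)

  DIR⊆DIR-CONV : ∀ {g k} → 2 ℕ.≤ k → (G : Graph g) → G ∈ k -DIR → G ∈ k DIR-CONV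
  DIR⊆DIR-CONV {k = k} 2≤k G (s , (m , m≤k , L₀ , parallel₀) , G≅s) =
      L , P
    , (λ i → parallelogram-∈𝒫 (s i) (0<su i) 0<ε L (proj₂ (parallel i)) (proj₂ (proj₂ (proj₂ (side i)))))
    , λ i j i≢j → mk⇔
        (λ ij → let x , x∈i , x∈j = Equivalence.to (G≅s i j i≢j) ij
                in  x , segment⊆strip (s i) (u i) ε x∈i , segment⊆strip (s j) (u j) ε x∈j)
        (λ Pi≬Pj → Equivalence.from (G≅s i j i≢j) (strips-meet i j Pi≬Pj))
    where
    L = proj₁ (extend-lines (ℕ.≤⇒≤′ m≤k) L₀)

    parallel : ∀ i → Σ[ j ∈ Fin k ] Parallel (Segment.start (s i)) (Segment.end (s i)) (Lines.line L j)
    parallel i =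
      let j₀ , s∥l = parallel₀ i
          j , eq   = proj₂ (extend-lines (ℕ.≤⇒≤′ m≤k) L₀) j₀
      in  j , ≡.subst (Parallel (Segment.start (s i)) (Segment.end (s i))) (≡.sym eq) s∥l

    side = λ i → left-transversal 2≤k L (s i) (proj₂ (parallel i))

    u : Fin (Graph.order G) → Point
    u i = proj₁ (side i)

    0<su : ∀ i → 0# < det (direction (s i)) (u i)
    0<su i = proj₁ (proj₂ (side i))

    -- Stated as an implication so that it holds for every `ε` when the segments meet, including `i`
    -- equal to `j`; only separated pairs constrain `ε`.
    StripsMeetOnlyIfSegmentsMeet = λ ε i j →
      ConvexHull (strip (s i) (u i) ε) ≬ ConvexHull (strip (s j) (u j) ε) → ⟦ s i ⟧ˢ ≬ ⟦ s j ⟧ˢ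

    eventually : ∀ i j → Eventually (λ ε → StripsMeetOnlyIfSegmentsMeet ε i j)
    eventually i j with meet⊎separated (s i) (s j)
    ... | inj₁ si≬sj     = eventually-always (λ _ _ → si≬sj)
    ... | inj₂ separated = eventually-map (λ disjoint meet → contradiction meet disjoint)
            (separated⇒strips-eventually-disjoint {s i} {s j} (u i) (u j) separated)

    thin : ∃[ ε ] (0# < ε × (∀ i j → StripsMeetOnlyIfSegmentsMeet ε i j))
    thin = eventually⇒∃ (eventually-∀ (λ i → eventually-∀ (eventually i)))

    ε = proj₁ thin
    0<ε = proj₁ (proj₂ thin)
    strips-meet = proj₂ (proj₂ thin)

    P : Fin (Graph.order G) → Polygon
    P i = parallelogram (s i) (0<su i) 0<ε

open import Data.Nat.Base using (ℕ; _≤_)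
open import Relation.Unary using (_∈_)

theorem1 : {c ℓ₁ ℓ₂ g : Level} (ℝ : Reals c ℓ₁ ℓ₂) (k : ℕ) → 2 ≤ k →
    let open Plane ℝ in
    (G : Graph g) → G ∈ k -DIR → G ∈ k DIR-CONV
theorem1 ℝ k 2≤k G = Thickening.DIR⊆DIR-CONV ℝ 2≤k G
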